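{- There exists a string family on which $\ell = o(\ell_e)$.
   Context: A string family is an infinite set of finite strings of unbounded length; asymptotic notation on a family refers to strings $w$ of the family with $n=|w|\to\infty$ (with constants uniform over the family). $w[i:j]$ denotes the substring of $w$ from position $i$ to position $j$ (positions start at 1). L-systems: an L-system is a tuple $(\Sigma,\varphi,\tau,s,d,n)$, where $\Sigma$ is a finite alphabet, $\varphi:\Sigma^*\to\Sigma^*$ is a non-erasing monoid endomorphism (each rule $a\to\varphi(a)$, $a\in\Sigma$, has $|\varphi(a)|\ge 1$), $\tau:\Sigma^*\to\Sigma^*$ is a coding (a morphism with $|\tau(a)|=1$ for all $a\in\Sigma$), $s\in\Sigma^+$ is the axiom, and $d\ge 0$, $n\ge 1$ are integers. It generates the unique string $\tau(\varphi^d(s))[1:n]$ of length $n$. It is always assumed that $d=n^{O(1)}$ and $|\Sigma|=n^{O(1)}$ (each value fits in an $O(\log n)$-bit word). The size of the L-system is $\sum_{a\in\Sigma}|\varphi(a)|+|s|+|\Sigma|+2$. The measure $\ell(w)$ is the size of the smallest L-system generating $w$. $\ell_e(w)$ is the size of the smallest L-system generating $w$ all of whose rules have size at least 2, i.e. $|\varphi(a)|\ge 2$ for all $a\in\Sigma$. -}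

module Defs where

open import Data.Empty using (⊥-elim)
open import Data.Fin.Base using (Fin; zero; suc)
open import Data.List.Base
  using (List; []; _∷_; length; map; concatMap; take; lookup; tabulate; sum; deduplicate)
open import Data.List.Membership.Propositional using (_∈_)
open import Data.List.Membership.Propositional.Properties using (∈-deduplicate⁺; ∈-lookup)
open import Data.List.Properties using (length-map; length-deduplicate; map-id; take-all)
open import Data.List.Relation.Unary.All as All using (All; []; _∷_)
open import Data.List.Relation.Unary.Any using (index)
open import Data.List.Relation.Unary.Any.Properties using (lookup-index)
open import Data.List.Relation.Unary.AllPairs using ([]; _∷_)
open import Data.List.Relation.Unary.Unique.Propositional using (Unique)
open import Data.List.Relation.Unary.Unique.DecPropositional.Properties using (deduplicate-!)
open import Data.Nat.Base using (ℕ; _+_; _*_; _^_; _≤_; z≤n; s≤s; >-nonZero)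
open import Data.Nat.GeneralisedArithmetic using (fold)
open import Data.Nat.Induction using (<-rec)
open import Data.Nat.Properties
  using (_≟_; ≤-refl; ≤-trans; ≤-reflexive; ≮⇒≥; *-identityʳ; ^-monoʳ-≤)
open import Data.Product.Base using (∃-syntax; _×_; _,_)
open import Function.Base using (id)
open import Function.Bundles using (_↣_; module Injection; mk↣)
open import Level using (0ℓ)
open import Relation.Binary.PropositionalEquality
  using (_≡_; refl; sym; trans; cong; subst)
open import Relation.Nullary using (¬_)
open import Relation.Unary using (Pred)

-- Symbols are drawn from the countable supply ℕ.

Word : Set
Word = List ℕ

-- The alphabet Σ is the image of `symbols`, a finite subset of ℕ with k
-- elements; letters are referred to by their index in Fin k.  The morphisms
-- φ and τ are given by their values on letters.

record LSystem : Set where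
  field
    k           : ℕ
    symbols     : Fin k ↣ ℕ
    φ           : Fin k → List (Fin k)
    non-erasing : ∀ a → 1 ≤ length (φ a)
    τ           : Fin k → Fin k
    s           : List (Fin k)
    s-nonempty  : 1 ≤ length s
    d           : ℕ
    n           : ℕ
    n-positive  : 1 ≤ n

  φ* : List (Fin k) → List (Fin k)
  φ* = concatMap φ

  τ* : List (Fin k) → List (Fin k)
  τ* = map τ

  output : Word
  output = map (Injection.to symbols) (take n (τ* (fold s φ* d)))

  size : ℕ
  size = sum (tabulate (λ a → length (φ a))) + length s + k + 2

open LSystem public using (size)

-- `take n` truncates silently when τ(φᵈ(s)) is shorter than n, hence the
-- second conjunct.

Generates : LSystem → Word → Set
Generates G w = output ≡ w × length w ≡ n
  where open LSystem G

Expanding : LSystem → Set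
Expanding G = ∀ a → 2 ≤ length (φ a)
  where open LSystem G

-- The assumption d = n^O(1), |Σ| = n^O(1) only has a meaning for a whole family
-- of L-systems, so the exponent c is a parameter of the measures ℓ and ℓₑ.

PolyBounded : ℕ → LSystem → Set
PolyBounded c G = d ≤ n ^ c × k ≤ n ^ c
  where open LSystem G

-- `MinSize P m`: m is the smallest size of an L-system satisfying P.

MinSize : Pred LSystem 0ℓ → ℕ → Set
MinSize P m = (∃[ G ] (P G × size G ≡ m)) × (∀ G → P G → m ≤ size G)

-- A measure is given by its graph: `μ w m` reads μ(w) = m.

Measure : Set₁
Measure = Word → ℕ → Set

ℓ : ℕ → Measure
ℓ c w = MinSize λ G → PolyBounded c G × Generates G w

ℓₑ : ℕ → Measure
ℓₑ c w = MinSize λ G → Expanding G × PolyBounded c G × Generates G w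

-- An infinite set of strings is implied by unbounded length.

StringFamily : Pred Word 0ℓ → Set
StringFamily F = ∀ N → ∃[ w ] (F w × N ≤ length w)

-- μ = o(ν) on F: for every ε = 1/q, μ(w) ≤ ε ν(w) for all long enough w in F.
-- Quantifying over all values m, e is not vacuous for ℓ and ℓₑ: see
-- `ℓ-defined` and `ℓₑ-defined` (and ≤ on ℕ is ¬¬-stable).

_=o[_]_ : Measure → Pred Word 0ℓ → Measure → Set
μ =o[ F ] ν =
  ∀ (q : ℕ) → ∃[ N ] (∀ w → F w → N ≤ length w → ∀ m e → μ w m → ν w e → q * m ≤ e)

minSize-defined : ∀ {P} → (∃[ G ] P G) → ¬ ¬ (∃[ m ] MinSize P m)
minSize-defined {P} (G , pG) none = noSize (size G) G pG refl
  where
  noSize : ∀ m → ∀ H → P H → ¬ (size H ≡ m)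
  noSize = <-rec _ λ m rec H pH eq →
    none (m , (H , pH , eq) , λ K pK → ≮⇒≥ λ lt → rec lt K pK refl)

lookup-injective : ∀ {xs : List ℕ} → Unique xs → ∀ i j → lookup xs i ≡ lookup xs j → i ≡ j
lookup-injective (_  ∷ _) zero    zero    _  = refl
lookup-injective (x∉ ∷ _) zero    (suc j) eq = ⊥-elim (All.lookup x∉ (∈-lookup j) eq)
lookup-injective (x∉ ∷ _) (suc i) zero    eq = ⊥-elim (All.lookup x∉ (∈-lookup i) (sym eq))
lookup-injective (_  ∷ u) (suc i) (suc j) eq = cong suc (lookup-injective u i j eq)

-- The L-system with s spelling w itself, d = 0 and rules a → aa.

literal : ∀ c w → 1 ≤ c → 1 ≤ length w →
          ∃[ G ] (Expanding G × PolyBounded c G × Generates G w)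
literal c w 1≤c 1≤w = G , (λ _ → ≤-refl) , (z≤n , k≤n^c) , generates , refl
  where
  letters : List ℕ
  letters = deduplicate _≟_ w

  spell : ∀ {v} → All (_∈ letters) v → List (Fin (length letters))
  spell []       = []
  spell (p ∷ ps) = index p ∷ spell ps

  map-spell : ∀ {v} (ps : All (_∈ letters) v) → map (lookup letters) (spell ps) ≡ v
  map-spell []       = refl
  map-spell (p ∷ ps) rewrite map-spell ps | sym (lookup-index p) = refl

  w⊆letters : All (_∈ letters) w
  w⊆letters = All.tabulate (∈-deduplicate⁺ _≟_)

  axiom : List (Fin (length letters))
  axiom = spell w⊆letters

  length-axiom : length axiom ≡ length w
  length-axiom = trans (sym (length-map (lookup letters) axiom))
                       (cong length (map-spell w⊆letters))

  G : LSystem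
  G = record
    { k           = length letters
    ; symbols     = mk↣ {to = lookup letters} (lookup-injective (deduplicate-! _≟_ w) _ _)
    ; φ           = λ a → a ∷ a ∷ []
    ; non-erasing = λ _ → s≤s z≤n
    ; τ           = id
    ; s           = axiom
    ; s-nonempty  = subst (1 ≤_) (sym length-axiom) 1≤w
    ; d           = 0
    ; n           = length w
    ; n-positive  = 1≤w
    }

  k≤n^c : length letters ≤ length w ^ c
  k≤n^c = ≤-trans (length-deduplicate _≟_ w)
    (≤-trans (≤-reflexive (sym (*-identityʳ (length w))))
             (^-monoʳ-≤ (length w) {{>-nonZero 1≤w}} 1≤c))

  generates : LSystem.output G ≡ w
  generates =
    trans (cong (map (lookup letters))
            (trans (cong (take (length w)) (map-id axiom))
                   (take-all (length w) axiom (≤-reflexive length-axiom))))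
          (map-spell w⊆letters)

ℓ-defined : ∀ c w → 1 ≤ c → 1 ≤ length w → ¬ ¬ (∃[ m ] ℓ c w m)
ℓ-defined c w 1≤c 1≤w with G , _ , p ← literal c w 1≤c 1≤w = minSize-defined (G , p)

ℓₑ-defined : ∀ c w → 1 ≤ c → 1 ≤ length w → ¬ ¬ (∃[ m ] ℓₑ c w m)
ℓₑ-defined c w 1≤c 1≤w = minSize-defined (literal c w 1≤c 1≤w)

{-# OPTIONS --safe #-}
module Submission where

-- A gap of a word is the number of letters strictly between two consecutive
-- occurrences of 1.  In a concatenation f a₁ ⋯ f aᵣ every gap lies in some
-- f aᵢ or crosses the end of one of them, and each end is crossed by at most
-- one gap.  So each application of φ contributes at most Σ |φ(a)| new gap
-- values, and a word obtained by L applications has at most (L + 1) · size of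
-- them.  When all rules have size at least 2, log n applications suffice for a
-- prefix of length n: after more of them, the image of a single letter covers
-- the prefix.  Hence n-letter words with √n distinct gaps have ℓₑ ≥ √n / log n.
-- On the other hand 2 → 21, 1 → 10, 0 → 0 produces, in d steps, a word with
-- gaps 0, 1, …, d − 2.

open import Defs
open import Data.Fin.Base using (Fin; zero; suc; toℕ)
open import Data.Fin.Properties using (injective⇒≤; toℕ-injective)
open import Data.List.Base
  using (List; []; _∷_; [_]; _++_; _∷ʳ_; length; map; concat; concatMap; take; drop;
         lookup; tabulate; foldl; replicate; upTo)
open import Data.List.Membership.Propositional using (_∈_)
open import Data.List.Membership.Propositional.Properties
  using (∈-++⁺ˡ; ∈-++⁺ʳ; ∈-++⁻; ∈-concat⁺′; ∈-tabulate⁺; ∈-lookup)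
open import Data.List.Properties
  using (++-assoc; ++-identityʳ; length-++; length-take; length-map; length-replicate;
         length-upTo; map-++; map-∘; take-map; take-all; take++drop≡id; concatMap-++;
         map-concatMap; foldl-++; upTo-∷ʳ)
open import Data.List.Relation.Binary.Subset.Propositional using (_⊆_)
open import Data.List.Relation.Unary.Any using (here; there; index)
open import Data.List.Relation.Unary.Any.Properties using (lookup-index)
open import Data.List.Relation.Unary.Unique.Propositional using (Unique)
open import Data.List.Relation.Unary.Unique.Propositional.Properties using (upTo⁺)
open import Data.Maybe.Base as Maybe using (Maybe; just; nothing)
open import Data.Nat using (ℕ; zero; suc; _+_; _*_; _∸_; _^_; _≤_; z≤n; s≤s; >-nonZero)
open import Data.Nat.GeneralisedArithmetic using (fold; fold-+)
open import Data.Nat.ListAction using (sum)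
open import Data.Nat.Properties
open import Data.Nat.Tactic.RingSolver using (solve-∀)
open import Data.Product using (∃-syntax; _×_; _,_)
open import Data.Sum.Base using (_⊎_; inj₁; inj₂)
open import Function.Base using (_∘_)
open import Function.Bundles using (module Injection; mk↣)
open import Relation.Binary.PropositionalEquality
  using (_≡_; refl; sym; trans; cong; cong₂; subst; module ≡-Reasoning)
open import Relation.Nullary using (yes; no; contradiction)

private variable
  A B : Set

-- Counting and prefixes in lists.

unique-⊆⇒length-≤ : ∀ {xs ys : List ℕ} → Unique xs → xs ⊆ ys → length xs ≤ length ys
unique-⊆⇒length-≤ {xs} {ys} unique xs⊆ys = injective⇒≤ {f = position} position-injective
  where
  position : Fin (length xs) → Fin (length ys)
  position i = index (xs⊆ys (∈-lookup i))

  position-injective : ∀ {i j} → position i ≡ position j → i ≡ j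
  position-injective {i} {j} eq = lookup-injective unique i j
    (trans (lookup-index (xs⊆ys (∈-lookup i)))
    (trans (cong (lookup ys) eq) (sym (lookup-index (xs⊆ys (∈-lookup j))))))

length-concat-tabulate-≤ : ∀ {k} (f : Fin k → List A) (g : Fin k → ℕ) →
  (∀ i → length (f i) ≤ g i) → length (concat (tabulate f)) ≤ sum (tabulate g)
length-concat-tabulate-≤ {k = zero}  f g f≤g = z≤n
length-concat-tabulate-≤ {k = suc k} f g f≤g = ≤-trans
  (≤-reflexive (length-++ (f zero)))
  (+-mono-≤ (f≤g zero) (length-concat-tabulate-≤ (f ∘ suc) (g ∘ suc) (f≤g ∘ suc)))

take-++-≤ : ∀ n (xs : List A) {ys} → n ≤ length xs → take n (xs ++ ys) ≡ take n xs
take-++-≤ zero    xs       _         = refl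
take-++-≤ (suc n) (x ∷ xs) (s≤s n≤) = cong (x ∷_) (take-++-≤ n xs n≤)

-- Gaps

-- The state is the number of letters read since the last 1, if there was one.

next : Maybe ℕ → ℕ → Maybe ℕ
next st 1 = just 0
next st _ = Maybe.map suc st

emit : Maybe ℕ → ℕ → List ℕ
emit nothing  _ = []
emit (just c) 1 = [ c ]
emit (just c) _ = []

scan : Maybe ℕ → Word → List ℕ
scan st []      = []
scan st (x ∷ w) = emit st x ++ scan (next st x) w

gaps : Word → List ℕ
gaps = scan nothing

scan-++ : ∀ st v w → scan st (v ++ w) ≡ scan st v ++ scan (foldl next st v) w
scan-++ st []      w = refl
scan-++ st (x ∷ v) w = trans
  (cong (emit st x ++_) (scan-++ (next st x) v w))
  (sym (++-assoc (emit st x) _ _))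

-- The initial state matters only up to the first 1: reading it resets the state to `just 0`,
-- whatever came before. So only the first emitted value can depend on `st`.
scan-⊆ : ∀ st w {g} → g ∈ scan st w → g ∈ take 1 (scan st w) ⊎ g ∈ gaps w
scan-⊆ nothing  w                   g∈         = inj₂ g∈
scan-⊆ (just c) (0           ∷ w)   g∈         = scan-⊆ (just (suc c)) w g∈
scan-⊆ (just c) (1           ∷ w)   (here eq)  = inj₁ (here eq)
scan-⊆ (just c) (1           ∷ w)   (there g∈) = inj₂ g∈
scan-⊆ (just c) (suc (suc _) ∷ w)   g∈         = scan-⊆ (just (suc c)) w g∈

gaps-++ˡ : ∀ v w → gaps v ⊆ gaps (v ++ w)
gaps-++ˡ v w {g} g∈ = subst (g ∈_) (sym (scan-++ nothing v w)) (∈-++⁺ˡ g∈)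

gaps-take : ∀ n w → gaps (take n w) ⊆ gaps w
gaps-take n w {g} g∈ =
  subst ((g ∈_) ∘ gaps) (take++drop≡id n w) (gaps-++ˡ (take n w) (drop n w) g∈)

-- The gaps crossing the end of a factor f a of concatMap f u.

seams : (A → Word) → List A → List ℕ
seams f []      = []
seams f (a ∷ u) = take 1 (scan (foldl next nothing (f a)) (concatMap f u)) ++ seams f u

length-seams : ∀ (f : A → Word) u → length (seams f u) ≤ length u
length-seams f []      = z≤n
length-seams f (a ∷ u) = ≤-trans
  (≤-reflexive (length-++ (take 1 crossing)))
  (+-mono-≤ (≤-trans (≤-reflexive (length-take 1 crossing)) (m⊓n≤m 1 (length crossing)))
            (length-seams f u))
  where crossing = scan (foldl next nothing (f a)) (concatMap f u)

-- Scanning the rest from the state left by `f a` differs from scanning it afresh in at most the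
-- first emitted value, which is the one that `seams` records.
gaps-concatMap : ∀ (f : A → Word) u {g} → g ∈ gaps (concatMap f u) →
                 (∃[ a ] g ∈ gaps (f a)) ⊎ g ∈ seams f u
gaps-concatMap f (a ∷ u) {g} g∈
  with ∈-++⁻ (gaps (f a)) (subst (g ∈_) (scan-++ nothing (f a) (concatMap f u)) g∈)
... | inj₁ inFirst = inj₁ (a , inFirst)
... | inj₂ later with scan-⊆ (foldl next nothing (f a)) (concatMap f u) later
...   | inj₁ crossing = inj₂ (∈-++⁺ˡ crossing)
...   | inj₂ inRest with gaps-concatMap f u inRest
...     | inj₁ inBlock = inj₁ inBlock
...     | inj₂ onSeam  = inj₂ (∈-++⁺ʳ _ onSeam)

-- Iterated morphisms

iterate : (A → List A) → ℕ → List A → List A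
iterate φ j u = fold u (concatMap φ) j

iterate-++ : ∀ (φ : A → List A) j u v → iterate φ j (u ++ v) ≡ iterate φ j u ++ iterate φ j v
iterate-++ φ zero    u v = refl
iterate-++ φ (suc j) u v = trans (cong (concatMap φ) (iterate-++ φ j u v))
                                 (concatMap-++ φ (iterate φ j u) (iterate φ j v))

iterate-concatMap : ∀ (φ : A → List A) j u →
                    iterate φ j u ≡ concatMap (λ a → iterate φ j [ a ]) u
iterate-concatMap φ zero    []      = refl
iterate-concatMap φ (suc j) []      = cong (concatMap φ) (iterate-concatMap φ j [])
iterate-concatMap φ j       (a ∷ u) = trans (iterate-++ φ j [ a ] u)
  (cong (iterate φ j [ a ] ++_) (iterate-concatMap φ j u))

-- `fold` adds the new application on the outside; moving it to the inside exhibits the image of `a`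
-- as the concatenation of the level `j` images of the letters of `φ a`.
iterate-suc : ∀ (φ : A → List A) j a → iterate φ (suc j) [ a ] ≡ iterate φ j (φ a)
iterate-suc φ j a = begin
  iterate φ (suc j) [ a ]   ≡⟨ cong (λ i → iterate φ i [ a ]) (+-comm 1 j) ⟩
  iterate φ (j + 1) [ a ]   ≡⟨ fold-+ [ a ] (concatMap φ) j ⟩
  iterate φ j (φ a ++ [])   ≡⟨ cong (iterate φ j) (++-identityʳ (φ a)) ⟩
  iterate φ j (φ a)         ∎
  where open ≡-Reasoning

length-concatMap-≥ : ∀ {φ : A → List B} {m} → (∀ a → m ≤ length (φ a)) →
                     ∀ u → length u * m ≤ length (concatMap φ u)
length-concatMap-≥         φ≥m []      = z≤n
length-concatMap-≥ {φ = φ} φ≥m (a ∷ u) = ≤-trans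
  (+-mono-≤ (φ≥m a) (length-concatMap-≥ φ≥m u)) (≤-reflexive (sym (length-++ (φ a))))

length-iterate-≥ : ∀ {φ : A → List A} {m} → (∀ a → m ≤ length (φ a)) →
                   ∀ j u → length u * m ^ j ≤ length (iterate φ j u)
length-iterate-≥ φ≥m zero    u = ≤-reflexive (*-identityʳ (length u))
length-iterate-≥ {φ = φ} {m} φ≥m (suc j) u = begin
  length u * (m * m ^ j)         ≡⟨ cong (length u *_) (*-comm m (m ^ j)) ⟩
  length u * (m ^ j * m)         ≡⟨ *-assoc (length u) (m ^ j) m ⟨
  length u * m ^ j * m           ≤⟨ *-monoˡ-≤ m (length-iterate-≥ φ≥m j u) ⟩
  length (iterate φ j u) * m     ≤⟨ length-concatMap-≥ φ≥m (iterate φ j u) ⟩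
  length (iterate φ (suc j) u)   ∎
  where open ≤-Reasoning

-- Gap values in iterated images.

module _ {k} (φ : Fin k → List (Fin k)) (h : Fin k → ℕ) where

  block : ℕ → Fin k → Word
  block j a = map h (iterate φ j [ a ])

  map-iterate : ∀ j u → map h (iterate φ j u) ≡ concatMap (block j) u
  map-iterate j u = trans (cong (map h) (iterate-concatMap φ j u))
                          (map-concatMap h (λ a → iterate φ j [ a ]) u)

  -- One list serves all letters at once. Passing to level `suc j` creates new values only at seams
  -- between level `j` blocks, and these are laid out along the right-hand sides of the rules.
  blockGaps : ℕ → List ℕ
  blockGaps zero    = []
  blockGaps (suc j) = concat (tabulate λ a → seams (block j) (φ a)) ++ blockGaps j

  weight : ℕ
  weight = sum (tabulate λ a → length (φ a))

  length-blockGaps : ∀ j → length (blockGaps j) ≤ j * weight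
  length-blockGaps zero    = z≤n
  length-blockGaps (suc j) = ≤-trans
    (≤-reflexive (length-++ (concat (tabulate λ a → seams (block j) (φ a)))))
    (+-mono-≤ (length-concat-tabulate-≤ _ _ (λ a → length-seams (block j) (φ a)))
              (length-blockGaps j))

  gaps-block : ∀ j a → gaps (block j a) ⊆ blockGaps j
  gaps-block zero    a ()
  gaps-block (suc j) a {g} g∈
    with gaps-concatMap (block j) (φ a)
           (subst ((g ∈_) ∘ gaps) (trans (cong (map h) (iterate-suc φ j a)) (map-iterate j (φ a))) g∈)
  ... | inj₁ (b , inBlock) = ∈-++⁺ʳ _ (gaps-block j b inBlock)
  ... | inj₂ onSeam        = ∈-++⁺ˡ (∈-concat⁺′ onSeam (∈-tabulate⁺ a))

  gaps-iterate : ∀ j u → gaps (map h (iterate φ j u)) ⊆ seams (block j) u ++ blockGaps j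
  gaps-iterate j u {g} g∈
    with gaps-concatMap (block j) u (subst ((g ∈_) ∘ gaps) (map-iterate j u) g∈)
  ... | inj₁ (a , inBlock) = ∈-++⁺ʳ _ (gaps-block j a inBlock)
  ... | inj₂ onSeam        = ∈-++⁺ˡ onSeam

  -- Distinct gaps cannot outnumber the list of possible values: one seam per letter of `u`, and
  -- `weight` values per application of the morphism.
  unique-gaps-≤ : ∀ n j u → Unique (gaps (take n (map h (iterate φ j u)))) →
                  length (gaps (take n (map h (iterate φ j u)))) ≤ length u + j * weight
  unique-gaps-≤ n j u unique = ≤-trans
    (unique-⊆⇒length-≤ unique (gaps-iterate j u ∘ gaps-take n (map h (iterate φ j u))))
    (≤-trans (≤-reflexive (length-++ (seams (block j) u)))
             (+-mono-≤ (length-seams (block j) u) (length-blockGaps j)))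

-- For an expanding φ, the prefix of length n ≤ 2^L of φᵈ(u) depends only on
-- φᵈ⁻ᴸ(u), and there only on the first letter.

prefix-iterate : ∀ (φ : A → List A) → (∀ a → 2 ≤ length (φ a)) → ∀ n L → n ≤ 2 ^ L →
  ∀ d u → 1 ≤ length u → L ≤ d →
  ∃[ a ] take n (iterate φ d u) ≡ take n (iterate φ L [ a ])
prefix-iterate φ expanding n L n≤2^L d u 1≤u L≤d
  with iterate φ (d ∸ L) u in top
     -- This bound makes the intermediate word nonempty and so excludes the case of an empty list.
     | ≤-trans (*-mono-≤ 1≤u (m^n>0 2 (d ∸ L))) (length-iterate-≥ {φ = φ} expanding (d ∸ L) u)
... | a ∷ v | _ = a , (begin
  take n (iterate φ d u)
    ≡⟨ cong (λ i → take n (iterate φ i u)) (m+[n∸m]≡n L≤d) ⟨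
  take n (iterate φ (L + (d ∸ L)) u)
    ≡⟨ cong (take n) (fold-+ u (concatMap φ) L) ⟩
  take n (iterate φ L (iterate φ (d ∸ L) u))
    ≡⟨ cong (take n ∘ iterate φ L) top ⟩
  take n (iterate φ L (a ∷ v))
    ≡⟨ cong (take n) (iterate-++ φ L [ a ] v) ⟩
  take n (iterate φ L [ a ] ++ iterate φ L v)
    ≡⟨ take-++-≤ n (iterate φ L [ a ]) n≤ ⟩
  take n (iterate φ L [ a ]) ∎)
  where
  open ≡-Reasoning
  n≤ : n ≤ length (iterate φ L [ a ])
  n≤ = ≤-trans n≤2^L (≤-trans (≤-reflexive (sym (*-identityˡ (2 ^ L))))
                              (length-iterate-≥ {φ = φ} expanding L [ a ]))

-- Either `d` is at most `L`, or the word is already a prefix of the `L`-fold image of one letter.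
-- In both cases at most `L` applications start from a word no longer than the axiom; the axiom
-- accounts for one multiple of the size, the applications for `L`.
expanding-gaps-≤ : ∀ G w L → Expanding G → Generates G w → length w ≤ 2 ^ L →
                   Unique (gaps w) → length (gaps w) ≤ suc L * size G
expanding-gaps-≤ G w L expanding (output≡w , length≡n) short unique = bound
  where
  open LSystem G hiding (size)

  h : Fin k → ℕ
  h = Injection.to symbols ∘ τ

  prefix≡w : ∀ d′ u → take n (iterate φ d s) ≡ take n (iterate φ d′ u) →
             take n (map h (iterate φ d′ u)) ≡ w
  prefix≡w d′ u eq = begin
    take n (map h (iterate φ d′ u))  ≡⟨ take-map n (iterate φ d′ u) ⟩
    map h (take n (iterate φ d′ u))  ≡⟨ cong (map h) eq ⟨
    map h (take n (iterate φ d s))   ≡⟨ map-∘ (take n (iterate φ d s)) ⟩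
    map (Injection.to symbols) (map τ (take n (iterate φ d s)))
      ≡⟨ cong (map (Injection.to symbols)) (take-map n (iterate φ d s)) ⟨
    output                           ≡⟨ output≡w ⟩
    w                                ∎
    where
    open ≡-Reasoning

  ≤-via : ∀ d′ u → d′ ≤ L → length u ≤ length s →
          take n (iterate φ d s) ≡ take n (iterate φ d′ u) →
          length (gaps w) ≤ suc L * size G
  ≤-via d′ u d′≤L u≤s eq = begin
    length (gaps w)
      ≡⟨ cong (length ∘ gaps) (prefix≡w d′ u eq) ⟨
    length (gaps (take n (map h (iterate φ d′ u))))
      ≤⟨ unique-gaps-≤ φ h n d′ u (subst (Unique ∘ gaps) (sym (prefix≡w d′ u eq)) unique) ⟩
    length u + d′ * weight φ h
      ≤⟨ +-mono-≤ (≤-trans u≤s s≤size) (*-mono-≤ d′≤L weight≤size) ⟩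
    suc L * size G ∎
    where
    open ≤-Reasoning
    weight+s≤size : weight φ h + length s ≤ size G
    weight+s≤size = ≤-trans (m≤m+n _ k) (m≤m+n _ 2)
    weight≤size = ≤-trans (m≤m+n (weight φ h) (length s)) weight+s≤size
    s≤size = ≤-trans (m≤n+m (length s) (weight φ h)) weight+s≤size

  bound : length (gaps w) ≤ suc L * size G
  bound with ≤-total d L
  ... | inj₁ d≤L = ≤-via d s d≤L ≤-refl refl
  ... | inj₂ L≤d with a , eq ← prefix-iterate φ expanding n L (subst (_≤ 2 ^ L) length≡n short)
                                 d s s-nonempty L≤d
                 = ≤-via L [ a ] ≤-refl s-nonempty eq

-- The word 0 1 10 100 ⋯ 10^(d−1)

rule : Fin 3 → List (Fin 3)
rule zero             = [ zero ]
rule (suc zero)       = suc zero ∷ zero ∷ []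
rule (suc (suc zero)) = suc (suc zero) ∷ suc zero ∷ []

-- The letter 2 stays in first place, ahead of every 1; printed as 0, it enters no gap.
coding : Fin 3 → Fin 3
coding zero             = zero
coding (suc zero)       = suc zero
coding (suc (suc zero)) = zero

decode : List (Fin 3) → Word
decode = map toℕ ∘ map coding

unfolded : ℕ → List (Fin 3)
unfolded d = iterate rule d [ suc (suc zero) ]

staircase : ℕ → Word
staircase d = decode (unfolded d)

iterate-rule-0 : ∀ d → iterate rule d [ zero ] ≡ [ zero ]
iterate-rule-0 zero    = refl
iterate-rule-0 (suc d) = cong (concatMap rule) (iterate-rule-0 d)

iterate-rule-1 : ∀ d → iterate rule d [ suc zero ] ≡ suc zero ∷ replicate d zero
iterate-rule-1 zero    = refl
iterate-rule-1 (suc d) = trans (cong (concatMap rule) (iterate-rule-1 d))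
                               (cong (λ u → suc zero ∷ zero ∷ u) (fixed d))
  where
  fixed : ∀ d → concatMap rule (replicate d zero) ≡ replicate d zero
  fixed zero    = refl
  fixed (suc d) = cong (zero ∷_) (fixed d)

-- The first application turns 2 into 21; the remaining `d` expand the 2 to `unfolded d` and the 1
-- to a 1 followed by `d` zeros.
unfolded-suc : ∀ d → unfolded (suc d) ≡ unfolded d ++ suc zero ∷ replicate d zero
unfolded-suc d = begin
  unfolded (suc d)                                  ≡⟨ iterate-suc rule d _ ⟩
  iterate rule d (suc (suc zero) ∷ suc zero ∷ [])   ≡⟨ iterate-++ rule d [ suc (suc zero) ] _ ⟩
  unfolded d ++ iterate rule d [ suc zero ]         ≡⟨ cong (unfolded d ++_) (iterate-rule-1 d) ⟩
  unfolded d ++ suc zero ∷ replicate d zero         ∎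
  where open ≡-Reasoning

decode-++ : ∀ u v → decode (u ++ v) ≡ decode u ++ decode v
decode-++ u v = trans (cong (map toℕ) (map-++ coding u v)) (map-++ toℕ (map coding u) _)

decode-zeros : ∀ d → decode (replicate d zero) ≡ replicate d 0
decode-zeros zero    = refl
decode-zeros (suc d) = cong (0 ∷_) (decode-zeros d)

staircase-suc : ∀ d → staircase (suc d) ≡ staircase d ++ 1 ∷ replicate d 0
staircase-suc d = begin
  staircase (suc d)                                 ≡⟨ cong decode (unfolded-suc d) ⟩
  decode (unfolded d ++ suc zero ∷ replicate d zero) ≡⟨ decode-++ (unfolded d) _ ⟩
  staircase d ++ 1 ∷ decode (replicate d zero)
    ≡⟨ cong (λ v → staircase d ++ 1 ∷ v) (decode-zeros d) ⟩
  staircase d ++ 1 ∷ replicate d 0                  ∎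
  where open ≡-Reasoning

-- Gaps of the staircase words.

scan-zeros : ∀ st d → scan st (replicate d 0) ≡ []
scan-zeros st       zero    = refl
scan-zeros nothing  (suc d) = scan-zeros nothing d
scan-zeros (just c) (suc d) = scan-zeros (just (suc c)) d

state-zeros : ∀ c d → foldl next (just c) (replicate d 0) ≡ just (d + c)
state-zeros c zero    = refl
state-zeros c (suc d) = trans (state-zeros (suc c) d) (cong just (+-suc d c))

state-staircase : ∀ d → foldl next nothing (staircase (suc d)) ≡ just d
state-staircase d = begin
  foldl next nothing (staircase (suc d))
    ≡⟨ cong (foldl next nothing) (staircase-suc d) ⟩
  foldl next nothing (staircase d ++ 1 ∷ replicate d 0)
    ≡⟨ foldl-++ next nothing (staircase d) _ ⟩
  foldl next (just 0) (replicate d 0)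
    ≡⟨ state-zeros 0 d ⟩
  just (d + 0)
    ≡⟨ cong just (+-identityʳ d) ⟩
  just d ∎
  where open ≡-Reasoning

-- The 1 that opens the appended block closes a run of `d` zeros and emits `d`; the zeros after it
-- emit nothing.
gaps-staircase : ∀ d → gaps (staircase (suc d)) ≡ upTo d
gaps-staircase zero    = refl
gaps-staircase (suc d) = begin
  gaps (staircase (2 + d))
    ≡⟨ cong gaps (staircase-suc (suc d)) ⟩
  gaps (staircase (suc d) ++ 1 ∷ replicate (suc d) 0)
    ≡⟨ scan-++ nothing (staircase (suc d)) _ ⟩
  gaps (staircase (suc d)) ++ scan (foldl next nothing (staircase (suc d))) (1 ∷ replicate (suc d) 0)
    ≡⟨ cong₂ (λ v st → v ++ scan st (1 ∷ replicate (suc d) 0))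
             (gaps-staircase d) (state-staircase d) ⟩
  upTo d ++ d ∷ scan (just 0) (replicate (suc d) 0)
    ≡⟨ cong (λ v → upTo d ++ d ∷ v) (scan-zeros (just 0) (suc d)) ⟩
  upTo d ∷ʳ d
    ≡⟨ upTo-∷ʳ d ⟩
  upTo (suc d) ∎
  where open ≡-Reasoning

-- Length of the staircase words.

length-staircase-suc : ∀ d → length (staircase (suc d)) ≡ length (staircase d) + suc d
length-staircase-suc d = trans (cong length (staircase-suc d))
  (trans (length-++ (staircase d)) (cong (λ m → length (staircase d) + suc m) (length-replicate d)))

length-staircase-≥ : ∀ d → suc d ≤ length (staircase d)
length-staircase-≥ zero    = ≤-refl
length-staircase-≥ (suc d) = begin
  2 + d                          ≡⟨ +-comm 1 (suc d) ⟩
  suc d + 1                      ≤⟨ +-mono-≤ (length-staircase-≥ d) (s≤s z≤n) ⟩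
  length (staircase d) + suc d   ≡⟨ length-staircase-suc d ⟨
  length (staircase (suc d))     ∎
  where open ≤-Reasoning

-- The exact length is 1 + d(d+1)/2; a bound without division is enough.
length-staircase-≤ : ∀ d → length (staircase d) ≤ suc (d * d)
length-staircase-≤ zero    = ≤-refl
length-staircase-≤ (suc d) = begin
  length (staircase (suc d))     ≡⟨ length-staircase-suc d ⟩
  length (staircase d) + suc d   ≤⟨ +-monoˡ-≤ (suc d) (length-staircase-≤ d) ⟩
  suc (d * d) + suc d            ≤⟨ m≤m+n _ d ⟩
  suc (d * d) + suc d + d        ≡⟨ expand d ⟩
  suc (suc d * suc d)            ∎
  where
  open ≤-Reasoning
  expand : ∀ d → suc (d * d) + suc d + d ≡ suc (suc d * suc d)
  expand = solve-∀

-- An L-system of constant size for the staircase words.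

staircaseSystem : ℕ → LSystem
staircaseSystem d = record
  { k           = 3
  ; symbols     = mk↣ {to = toℕ} toℕ-injective
  ; φ           = rule
  ; non-erasing = λ where
      zero             → s≤s z≤n
      (suc zero)       → s≤s z≤n
      (suc (suc zero)) → s≤s z≤n
  ; τ           = coding
  ; s           = [ suc (suc zero) ]
  ; s-nonempty  = s≤s z≤n
  ; d           = d
  ; n           = length (staircase d)
  ; n-positive  = ≤-trans (s≤s z≤n) (length-staircase-≥ d)
  }

staircaseSystem-generates : ∀ d → Generates (staircaseSystem d) (staircase d)
staircaseSystem-generates d = cong (map toℕ) (take-all _ (map coding (unfolded d))
  (≤-reflexive (sym (length-map toℕ (map coding (unfolded d)))))) , refl

-- The length exceeds `d`, so it is at least 3 once `d` is at least 2, and the first power already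
-- bounds both parameters.
staircaseSystem-polyBounded : ∀ c d → 1 ≤ c → 2 ≤ d → PolyBounded c (staircaseSystem d)
staircaseSystem-polyBounded c d 1≤c 2≤d =
  ≤-trans (n≤1+n d) (≤-trans (length-staircase-≥ d) n≤n^c) ,
  ≤-trans (s≤s 2≤d) (≤-trans (length-staircase-≥ d) n≤n^c)
  where
  n = length (staircase d)
  n≤n^c : n ≤ n ^ c
  n≤n^c = ≤-trans (≤-reflexive (sym (*-identityʳ n)))
    (^-monoʳ-≤ n {{>-nonZero (≤-trans (s≤s z≤n) (length-staircase-≥ d))}} 1≤c)

-- The family is sparse so that the logarithm of the length is explicit.

gapCount : ℕ → ℕ
gapCount t = 2 ^ t * 2 ^ t

-- With the index shifted by one, the number of gaps is exactly `gapCount t`.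
member : ℕ → Word
member t = staircase (suc (gapCount t))

Family : Word → Set
Family w = ∃[ t ] w ≡ member t

1+n≤2^n : ∀ n → suc n ≤ 2 ^ n
1+n≤2^n zero    = ≤-refl
1+n≤2^n (suc n) = begin
  2 + n          ≤⟨ s≤s (s≤s (m≤m+n n (n + 0))) ⟩
  2 + 2 * n      ≡⟨ *-suc 2 n ⟨
  2 * suc n      ≤⟨ *-monoʳ-≤ 2 (1+n≤2^n n) ⟩
  2 ^ suc n      ∎
  where open ≤-Reasoning

1+t≤gapCount : ∀ t → suc t ≤ gapCount t
1+t≤gapCount t = ≤-trans (1+n≤2^n t) (m≤m*n (2 ^ t) (2 ^ t) {{m^n≢0 2 t}})

length-member-≥ : ∀ t → t ≤ length (member t)
length-member-≥ t = ≤-trans (n≤1+n t)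
  (≤-trans (1+t≤gapCount t) (≤-trans (n≤1+n _) (≤-trans (n≤1+n _) (length-staircase-≥ _))))

length-member-≤ : ∀ t → length (member t) ≤ 2 ^ (4 * t + 3)
length-member-≤ t = begin
  length (member t)           ≤⟨ length-staircase-≤ (suc J) ⟩
  suc (suc J * suc J)         ≤⟨ +-mono-≤ (*-mono-≤ 1≤J 1≤J) (*-mono-≤ 1+J≤2J 1+J≤2J) ⟩
  -- Rounding 5J² up to 8J² makes the bound a power of two.
  J * J + (J + J) * (J + J)   ≤⟨ m≤m+n _ (3 * (J * J)) ⟩
  J * J + (J + J) * (J + J) + 3 * (J * J)
                              ≡⟨ collect (2 ^ t) ⟩
  2 ^ t * (2 ^ t * (2 ^ t * (2 ^ t * 1))) * 8
                              ≡⟨ cong (_* 8) (^-*-assoc 2 t 4) ⟩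
  2 ^ (t * 4) * 2 ^ 3         ≡⟨ ^-distribˡ-+-* 2 (t * 4) 3 ⟨
  2 ^ (t * 4 + 3)             ≡⟨ cong (λ e → 2 ^ (e + 3)) (*-comm t 4) ⟩
  2 ^ (4 * t + 3)             ∎
  where
  open ≤-Reasoning
  J = gapCount t
  1≤J : 1 ≤ J
  1≤J = ≤-trans (s≤s z≤n) (1+t≤gapCount t)
  1+J≤2J : suc J ≤ J + J
  1+J≤2J = +-monoˡ-≤ J 1≤J
  collect : ∀ x → x * x * (x * x) + (x * x + x * x) * (x * x + x * x) + 3 * (x * x * (x * x))
                  ≡ x * (x * (x * (x * 1))) * 8
  collect = solve-∀

-- Translates a threshold on the length, as the asymptotic statement asks for, into one on the
-- index.
member-long⇒ : ∀ T t → 2 ^ (4 * T + 3) ≤ length (member t) → T ≤ t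
member-long⇒ T t long with T ≤? t
... | yes T≤t = T≤t
... | no  T≰t = contradiction (≤-trans long (length-member-≤ t))
  (<⇒≱ (^-monoʳ-< 2 ≤-refl (+-monoˡ-< 3 (*-monoʳ-< 4 (≰⇒> T≰t)))))

-- Of the two factors `2 ^ t` in the number of gaps, one absorbs the logarithm of the length, up to
-- the constant 4, and is cancelled; the other is left as the lower bound.
member-expanding-size : ∀ t G → Expanding G → Generates G (member t) → 2 ^ t ≤ 4 * size G
member-expanding-size t G expanding generates = *-cancelˡ-≤ (2 ^ t) {{m^n≢0 2 t}} (begin
  gapCount t                    ≡⟨ length-upTo (gapCount t) ⟨
  length (upTo (gapCount t))    ≡⟨ cong length (gaps-staircase (gapCount t)) ⟨
  length (gaps (member t))      ≤⟨ expanding-gaps-≤ G (member t) (4 * t + 3) expanding generates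
                                     (length-member-≤ t) unique ⟩
  suc (4 * t + 3) * size G      ≡⟨ regroup t (size G) ⟩
  suc t * (4 * size G)          ≤⟨ *-monoˡ-≤ (4 * size G) (1+n≤2^n t) ⟩
  2 ^ t * (4 * size G)          ∎)
  where
  open ≤-Reasoning
  unique : Unique (gaps (member t))
  unique = subst Unique (sym (gaps-staircase (gapCount t))) (upTo⁺ (gapCount t))
  regroup : ∀ t e → suc (4 * t + 3) * e ≡ suc t * (4 * e)
  regroup = solve-∀

-- Separation of the two measures.

lemma8 : ∃[ F ] (StringFamily F ×
    (∃[ c₀ ] (∀ (c c′ : ℕ) → c₀ ≤ c → c₀ ≤ c′ → ℓ c =o[ F ] ℓₑ c′)))
lemma8 = Family , (λ N → member N , (N , refl) , length-member-≥ N) , 1 , separation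
  where
  separation : ∀ c c′ → 1 ≤ c → 1 ≤ c′ → ℓ c =o[ Family ] ℓₑ c′
  -- The threshold forces `t` to be at least 44q, where 44 is the size 11 of the small system times
  -- the 4 from `member-expanding-size`.
  separation c c′ 1≤c _ q = 2 ^ (4 * (44 * q) + 3) , bound
    where
    bound : ∀ w → Family w → 2 ^ (4 * (44 * q) + 3) ≤ length w →
            ∀ m e → ℓ c w m → ℓₑ c′ w e → q * m ≤ e
    bound _ (t , refl) long m _ (_ , m-minimal) ((G , (expanding , _ , generates) , refl) , _) =
      *-cancelˡ-≤ 4 (begin
        4 * (q * m)    ≤⟨ *-monoʳ-≤ 4 (*-monoʳ-≤ q m≤11) ⟩
        4 * (q * 11)   ≡⟨ regroup q ⟩
        44 * q         ≤⟨ member-long⇒ (44 * q) t long ⟩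
        t              ≤⟨ n≤1+n t ⟩
        suc t          ≤⟨ 1+n≤2^n t ⟩
        2 ^ t          ≤⟨ member-expanding-size t G expanding generates ⟩
        4 * size G     ∎)
      where
      open ≤-Reasoning
      -- Size of the small system: 5 for the rules, 1 for the axiom, 3 for the alphabet and 2 for
      -- the integers.
      m≤11 : m ≤ 11
      m≤11 = m-minimal (staircaseSystem (suc (gapCount t)))
        ( staircaseSystem-polyBounded c (suc (gapCount t)) 1≤c (s≤s (≤-trans (s≤s z≤n) (1+t≤gapCount t)))
        , staircaseSystem-generates (suc (gapCount t)) )
      regroup : ∀ q → 4 * (q * 11) ≡ 44 * q
      regroup = solve-∀
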